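{- For every fixed $d\geq 1$, the number of $U(d+1)$-free graphs on $N$ labeled vertices is at most $2^{O(N^{2-1/d}\log N)}$.
   Context: The universal graph $U(k)$ is the bipartite graph with color classes $A$ and $B=2^A$ where $|A|=k$, with $\{a,b\}$ an edge iff $a\in b$. A (simple, not necessarily bipartite) graph $G=(V,E)$ is $U(k)$-free if for every two disjoint sets $A,B\subset V$ with $|A|=k$ and $|B|=2^k$, the bipartite graph formed by the edges of $G$ between $A$ and $B$ is not isomorphic to $U(k)$. -}

module Defs where

open import Data.Nat using (ℕ; suc; _^_)
open import Data.Bool using (Bool; true; false)
open import Data.Fin using (Fin)
open import Data.Fin.Subset using (Subset)
open import Data.Vec using (lookup)
open import Data.Product using (∃-syntax; _×_)
open import Relation.Nullary using (¬_)
open import Relation.Binary.PropositionalEquality using (_≡_; _≢_)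
open import Function.Definitions using (Injective; Bijective)

record Graph (N : ℕ) : Set where
  field
    adj    : Fin N → Fin N → Bool
    sym    : ∀ i j → adj i j ≡ adj j i
    irrefl : ∀ i → adj i i ≡ false
open Graph public

Distinct : ∀ {N} → Graph N → Graph N → Set
Distinct G H = ¬ (∀ i j → adj G i j ≡ adj H i j)

-- The bipartite graph of G between A = image of a (|A| = k) and
-- B = image of b (|B| = 2^k) is isomorphic to U(k) (with A as the k-side):
-- there is a bijection β from B onto the power set of A with
-- a i ~ b j  iff  i ∈ β j.
ContainsUAt : ∀ {N} (k : ℕ) → Graph N → (Fin k → Fin N) → (Fin (2 ^ k) → Fin N) → Set
ContainsUAt k G a b =
  ∃[ β ] (Bijective {A = Fin (2 ^ k)} {B = Subset k} _≡_ _≡_ β ×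
          (∀ (i : Fin k) (j : Fin (2 ^ k)) → adj G (a i) (b j) ≡ lookup (β j) i))

UFree : ∀ {N} (k : ℕ) → Graph N → Set
UFree {N} k G =
  ∀ (a : Fin k → Fin N) (b : Fin (2 ^ k) → Fin N) →
    Injective _≡_ _≡_ a → Injective _≡_ _≡_ b →
    (∀ i j → a i ≢ b j) →
    ¬ ContainsUAt k G a b

{-# OPTIONS --safe #-}

-- A U(d+1)-free graph on n vertices has two vertices u ≠ v whose neighbourhoods
-- differ in O(n^(1-1/d)) vertices; recording u, v and the differences and
-- deleting u therefore encodes a graph on N vertices by N steps of
-- O(N^(1-1/d) log N) bits each. Deleting the column of u along with its row is
-- what avoids an extra logarithm when d = 1.
--
-- The near-twins come from Haussler's packing argument. For a tuple σ of
-- vertices, weigh each 0/1-pattern by the number of vertices outside σ having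
-- that adjacency pattern to σ; taking vertices outside σ makes the two sides of
-- a forbidden copy of U(d+1) disjoint. Since no d+1 coordinates are shattered,
-- the one-inclusion graph, with edges weighted by the minimum of their ends, has
-- weight at most d n. If all vertices were pairwise far apart, then a random
-- further coordinate would on average split a large minority off the classes of
-- an s-tuple, and summing over all (s+1)-tuples would contradict this bound.
module Submission where

open import Defs renaming (sym to adj-sym)
open import Data.Nat using (ℕ; zero; suc; _+_; _*_; _∸_; _^_; _≤_; _<_; _⊔_; _⊓_; z≤n; s≤s; ⌊_/2⌋; ⌈_/2⌉; NonZero; >-nonZero; _≤?_)
open import Data.Nat.Properties hiding (_≟_)
import Data.Nat.Properties as ℕ
open import Data.Nat.Induction using (<-rec)
open import Data.Nat.Logarithm using (⌈log₂_⌉; ⌈log₂⌉-mono-≤; ⌈log₂⌈n/2⌉⌉≡⌈log₂n⌉∸1)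
open import Data.Nat.Tactic.RingSolver using (solve-∀)
open import Data.Bool using (Bool; true; false; if_then_else_; _xor_)
import Data.Bool.Properties as Bool
open import Data.Fin using (Fin; zero; suc; lift; combine; finToFun; funToFin; punchIn; punchOut)
import Data.Fin as Fin
open import Data.Fin.Properties using (_≟_; any?; finToFun-funToFin; funToFin-finToFin; punchIn-injective; punchInᵢ≢i; punchIn-punchOut; pigeonhole)
open import Data.Fin.Subset using (Subset)
open import Data.Vec using (Vec; []; _∷_; lookup; insertAt)
import Data.Vec as Vec
open import Data.Vec.Properties using (lookup∘tabulate; tabulate∘lookup; tabulate-cong)
open import Data.Vec.Functional using () renaming (insertAt to insertAtᶠ)
open import Data.Vec.Functional.Properties using (insertAt-lookup; insertAt-punchIn)
open import Data.List using (List; []; _∷_; _++_; length; allFin; tabulate; filter; replicate; map; cartesianProduct; cartesianProductWith)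
import Data.List as List
open import Data.List.Properties using (length-tabulate; length-++; length-map; length-replicate)
open import Data.List.Membership.Propositional using (_∈_)
open import Data.List.Membership.Propositional.Properties using (∈-allFin; ∈-filter⁺; ∈-filter⁻; ∈-++⁺ˡ; ∈-++⁻; ∈-cartesianProduct⁺; ∈-cartesianProductWith⁺; ∈-lookup)
import Data.List.Membership.DecPropositional as DecMembership
open import Data.List.Relation.Unary.Any using (here; index)
open import Data.List.Relation.Unary.Any.Properties using (lookup-index)
open import Data.List.Relation.Unary.Unique.Propositional using (Unique)
open import Data.List.Relation.Unary.Unique.Propositional.Properties using (allFin⁺; filter⁺)
open import Data.List.Relation.Unary.AllPairs using (AllPairs; []; _∷_)
open import Data.List.Relation.Unary.All using (All; []; _∷_)
import Data.List.Relation.Unary.All as All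
import Data.List.Relation.Unary.All.Properties as All
open import Data.Product using (∃-syntax; Σ-syntax; _×_; _,_; proj₁; proj₂)
open import Data.Sum using (_⊎_; inj₁; inj₂)
open import Data.Empty using (⊥)
open import Function using (_∘_; id)
open import Function.Definitions using (Injective; Bijective)
open import Relation.Nullary using (¬_; Dec; yes; no; ⌊_⌋; _×-dec_; ¬?; contradiction)
open import Relation.Unary using (Decidable)
open import Relation.Binary.PropositionalEquality using (_≡_; _≢_; refl; sym; trans; cong; cong₂; cong-app; subst; module ≡-Reasoning)

-- Finite sums

∑ : ∀ {A : Set} → List A → (A → ℕ) → ℕ
∑ []       f = 0
∑ (x ∷ xs) f = f x + ∑ xs f

∑-mono : ∀ {A : Set} (xs : List A) {f g : A → ℕ} → (∀ x → f x ≤ g x) → ∑ xs f ≤ ∑ xs g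
∑-mono []       f≤g = z≤n
∑-mono (x ∷ xs) f≤g = +-mono-≤ (f≤g x) (∑-mono xs f≤g)

∑-cong : ∀ {A : Set} (xs : List A) {f g : A → ℕ} → (∀ x → f x ≡ g x) → ∑ xs f ≡ ∑ xs g
∑-cong []       f≡g = refl
∑-cong (x ∷ xs) f≡g = cong₂ _+_ (f≡g x) (∑-cong xs f≡g)

∑-zero : ∀ {A : Set} (xs : List A) → ∑ xs (λ _ → 0) ≡ 0
∑-zero []       = refl
∑-zero (x ∷ xs) = ∑-zero xs

∑-+ : ∀ {A : Set} (xs : List A) (f g : A → ℕ) → ∑ xs (λ x → f x + g x) ≡ ∑ xs f + ∑ xs g
∑-+ []       f g = refl
∑-+ (x ∷ xs) f g rewrite ∑-+ xs f g = interchange (f x) (g x) (∑ xs f) (∑ xs g)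
  where
  interchange : ∀ a b c d → a + b + (c + d) ≡ a + c + (b + d)
  interchange = solve-∀

∑-const : ∀ {A : Set} (xs : List A) k → ∑ xs (λ _ → k) ≡ length xs * k
∑-const []       k = refl
∑-const (x ∷ xs) k = cong (k +_) (∑-const xs k)

∑-swap : ∀ {A B : Set} (xs : List A) (ys : List B) (f : A → B → ℕ) →
  ∑ xs (λ x → ∑ ys (f x)) ≡ ∑ ys (λ y → ∑ xs (λ x → f x y))
∑-swap []       ys f = sym (∑-zero ys)
∑-swap (x ∷ xs) ys f = trans (cong (∑ ys (f x) +_) (∑-swap xs ys f)) (sym (∑-+ ys (f x) _))

∑-tabulate : ∀ {A : Set} {n} (g : Fin n → A) (f : A → ℕ) → ∑ (tabulate g) f ≡ ∑ (allFin n) (f ∘ g)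
∑-tabulate {n = zero}  g f = refl
∑-tabulate {n = suc n} g f = cong (f (g zero) +_)
  (trans (∑-tabulate (g ∘ suc) f) (sym (∑-tabulate suc (f ∘ g))))

∑-* : ∀ {A : Set} k (xs : List A) (f : A → ℕ) → ∑ xs (λ x → k * f x) ≡ k * ∑ xs f
∑-* k []       f = sym (*-zeroʳ k)
∑-* k (x ∷ xs) f = trans (cong (k * f x +_) (∑-* k xs f)) (sym (*-distribˡ-+ k (f x) _))

-- A 0/1-valued factor selects a sublist. With `h` a `hit` function, this turns the weight of a
-- pattern into a sum over the members of its class.
∑-filter : ∀ {A : Set} (xs : List A) (f h : A → ℕ) → (∀ x → h x ≤ 1) →
  ∑ xs (λ x → f x * h x) ≡ ∑ (filter (λ x → h x ℕ.≟ 1) xs) f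
∑-filter []       f h h≤1 = refl
∑-filter (x ∷ xs) f h h≤1 with h x in eq | h≤1 x
... | zero  | _       = cong₂ _+_ (*-zeroʳ (f x)) (∑-filter xs f h h≤1)
... | suc zero | _ = cong₂ _+_ (*-identityʳ (f x)) (∑-filter xs f h h≤1)
... | suc (suc _) | s≤s ()

length-filter≤∑ : ∀ {A : Set} {P : A → Set} (P? : Decidable P) (f : A → ℕ) →
  (∀ x → P x → 1 ≤ f x) → ∀ xs → length (filter P? xs) ≤ ∑ xs f
length-filter≤∑ P? f 1≤f []       = z≤n
length-filter≤∑ P? f 1≤f (x ∷ xs) with P? x
... | yes px = +-mono-≤ (1≤f x px) (length-filter≤∑ P? f 1≤f xs)
... | no  _  = m≤n⇒m≤o+n (f x) (length-filter≤∑ P? f 1≤f xs)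

length-allFin : ∀ n → length (allFin n) ≡ n
length-allFin n = length-tabulate id

∑ⱽ : ∀ {n} s → (Vec (Fin n) s → ℕ) → ℕ
∑ⱽ     zero    f = f []
∑ⱽ {n} (suc s) f = ∑ (allFin n) (λ c → ∑ⱽ s (λ σ → f (c ∷ σ)))

∑ⱽ-mono : ∀ {n} s {f g : Vec (Fin n) s → ℕ} → (∀ σ → f σ ≤ g σ) → ∑ⱽ s f ≤ ∑ⱽ s g
∑ⱽ-mono     zero    f≤g = f≤g []
∑ⱽ-mono {n} (suc s) f≤g = ∑-mono (allFin n) (λ c → ∑ⱽ-mono s (λ σ → f≤g (c ∷ σ)))

∑ⱽ-const : ∀ {n} s k → ∑ⱽ {n} s (λ _ → k) ≡ n ^ s * k
∑ⱽ-const     zero    k = sym (+-identityʳ k)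
∑ⱽ-const {n} (suc s) k = begin-equality
  ∑ (allFin n) (λ _ → ∑ⱽ s (λ _ → k))  ≡⟨ ∑-const (allFin n) _ ⟩
  length (allFin n) * ∑ⱽ s (λ _ → k)   ≡⟨ cong₂ _*_ (length-allFin n) (∑ⱽ-const s k) ⟩
  n * (n ^ s * k)                      ≡⟨ *-assoc n (n ^ s) k ⟨
  n * n ^ s * k                        ∎
  where open ≤-Reasoning

∑-∑ⱽ-swap : ∀ {A : Set} {n} (xs : List A) s (f : A → Vec (Fin n) s → ℕ) →
  ∑ xs (λ x → ∑ⱽ s (f x)) ≡ ∑ⱽ s (λ σ → ∑ xs (λ x → f x σ))
∑-∑ⱽ-swap         xs zero    f = refl
∑-∑ⱽ-swap {n = n} xs (suc s) f = trans
  (∑-swap xs (allFin n) (λ x c → ∑ⱽ s (λ σ → f x (c ∷ σ))))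
  (∑-cong (allFin n) (λ c → ∑-∑ⱽ-swap xs s (λ x σ → f x (c ∷ σ))))

-- Each tuple arises exactly once by inserting its entry at position `i` into the others. The double
-- counting uses this to read an edge in direction `i` as a split of a class of a shorter tuple.
∑ⱽ-insertAt : ∀ {n} s (i : Fin (suc s)) (f : Vec (Fin n) (suc s) → ℕ) →
  ∑ⱽ (suc s) f ≡ ∑ⱽ s (λ τ → ∑ (allFin n) (λ c → f (insertAt τ i c)))
∑ⱽ-insertAt {n} s       zero    f = ∑-∑ⱽ-swap (allFin n) s (λ c σ → f (c ∷ σ))
∑ⱽ-insertAt {n} (suc s) (suc i) f = ∑-cong (allFin n) (λ c → ∑ⱽ-insertAt s i (λ σ → f (c ∷ σ)))

-- Weights on the cube

Weight : ℕ → Set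
Weight n = Vec Bool n → ℕ

half : ∀ {n} → Bool → Weight (suc n) → Weight n
half b w p = w (b ∷ p)

_⊔ʷ_ _⊓ʷ_ : ∀ {n} → Weight n → Weight n → Weight n
(u ⊔ʷ v) p = u p ⊔ v p
(u ⊓ʷ v) p = u p ⊓ v p

-- For the indicator of a set family these are the projection along the first coordinate and the
-- family of patterns both of whose extensions are present.
upper lower : ∀ {n} → Weight (suc n) → Weight n
upper w = half false w ⊔ʷ half true w
lower w = half false w ⊓ʷ half true w

total : ∀ {n} → Weight n → ℕ
total {zero}  w = w []
total {suc n} w = total (half false w) + total (half true w)

total-mono : ∀ {n} {u v : Weight n} → (∀ p → u p ≤ v p) → total u ≤ total v
total-mono {zero}  u≤v = u≤v []
total-mono {suc n} u≤v = +-mono-≤ (total-mono (u≤v ∘ (false ∷_))) (total-mono (u≤v ∘ (true ∷_)))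

total-cong : ∀ {n} {u v : Weight n} → (∀ p → u p ≡ v p) → total u ≡ total v
total-cong {zero}  u≡v = u≡v []
total-cong {suc n} u≡v = cong₂ _+_ (total-cong (u≡v ∘ (false ∷_))) (total-cong (u≡v ∘ (true ∷_)))

total-+ : ∀ {n} (u v : Weight n) → total (λ p → u p + v p) ≡ total u + total v
total-+ {zero}  u v = refl
total-+ {suc n} u v
  rewrite total-+ (half false u) (half false v) | total-+ (half true u) (half true v)
  = interchange (total (half false u)) _ _ _
  where
  interchange : ∀ a b c d → a + b + (c + d) ≡ a + c + (b + d)
  interchange = solve-∀

total-zero : ∀ n → total {n} (λ _ → 0) ≡ 0
total-zero zero    = refl
total-zero (suc n) = cong₂ _+_ (total-zero n) (total-zero n)

total-* : ∀ {n} k (w : Weight n) → total (λ p → k * w p) ≡ k * total w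
total-* {zero}  k w = refl
total-* {suc n} k w = trans
  (cong₂ _+_ (total-* k (half false w)) (total-* k (half true w)))
  (sym (*-distribˡ-+ k (total (half false w)) _))

total-∑ : ∀ {A : Set} {n} (xs : List A) (f : A → Weight n) →
  total (λ p → ∑ xs (λ x → f x p)) ≡ ∑ xs (λ x → total (f x))
total-∑ {n = n} [] f = total-zero n
total-∑ (x ∷ xs)   f = trans (total-+ (f x) _) (cong (total (f x) +_) (total-∑ xs f))

m+n≡m⊔n+m⊓n : ∀ m n → m + n ≡ m ⊔ n + m ⊓ n
m+n≡m⊔n+m⊓n m n with ≤-total m n
... | inj₁ m≤n rewrite m≤n⇒m⊔n≡n m≤n | m≤n⇒m⊓n≡m m≤n = +-comm m n
... | inj₂ n≤m rewrite m≥n⇒m⊔n≡m n≤m | m≥n⇒m⊓n≡n n≤m = refl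

total-upper-lower : ∀ {n} (w : Weight (suc n)) → total w ≡ total (upper w) + total (lower w)
total-upper-lower w = begin-equality
  total (half false w) + total (half true w)       ≡⟨ total-+ (half false w) (half true w) ⟨
  total (λ p → half false w p + half true w p)     ≡⟨ total-cong (λ p → m+n≡m⊔n+m⊓n (half false w p) _) ⟩
  total (λ p → upper w p + lower w p)              ≡⟨ total-+ (upper w) (lower w) ⟩
  total (upper w) + total (lower w)                ∎
  where open ≤-Reasoning

-- The total weight of the one-inclusion graph, an edge weighing the minimum of its endpoints
edges : ∀ {n} → Weight n → ℕ
edges {zero}  w = 0
edges {suc n} w = total (lower w) + (edges (half false w) + edges (half true w))

edgesAt : ∀ {n} → Fin n → Weight n → ℕ
edgesAt zero    w = total (lower w)
edgesAt (suc i) w = edgesAt i (half false w) + edgesAt i (half true w)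

edges-∑ : ∀ {n} (w : Weight n) → edges w ≡ ∑ (allFin n) (λ i → edgesAt i w)
edges-∑ {zero}  w = refl
edges-∑ {suc n} w = cong (total (lower w) +_) (begin-equality
  edges (half false w) + edges (half true w)
    ≡⟨ cong₂ _+_ (edges-∑ (half false w)) (edges-∑ (half true w)) ⟩
  ∑ (allFin n) (λ i → edgesAt i (half false w)) + ∑ (allFin n) (λ i → edgesAt i (half true w))
    ≡⟨ ∑-+ (allFin n) _ _ ⟨
  ∑ (allFin n) (λ i → edgesAt (suc i) w)
    ≡⟨ ∑-tabulate suc (λ i → edgesAt i w) ⟨
  ∑ (tabulate suc) (λ i → edgesAt i w) ∎)
  where open ≤-Reasoning

edgesAt-insertAt : ∀ {n} (i : Fin (suc n)) (w : Weight (suc n)) →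
  edgesAt i w ≡ total (λ p → w (insertAt p i false) ⊓ w (insertAt p i true))
edgesAt-insertAt         zero    w = refl
edgesAt-insertAt {suc n} (suc i) w =
  cong₂ _+_ (edgesAt-insertAt i (half false w)) (edgesAt-insertAt i (half true w))

-- The two minima are traded for their own maximum and minimum, which are bounded separately by the
-- two summands on the right.
⊓-supermodular : ∀ a b c d → (a ⊓ b) + (c ⊓ d) ≤ ((a ⊔ c) ⊓ (b ⊔ d)) + ((a ⊓ c) ⊓ (b ⊓ d))
⊓-supermodular a b c d = begin
  (a ⊓ b) + (c ⊓ d)                          ≡⟨ m+n≡m⊔n+m⊓n (a ⊓ b) (c ⊓ d) ⟩
  ((a ⊓ b) ⊔ (c ⊓ d)) + ((a ⊓ b) ⊓ (c ⊓ d))  ≤⟨ +-mono-≤ join meet ⟩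
  ((a ⊔ c) ⊓ (b ⊔ d)) + ((a ⊓ c) ⊓ (b ⊓ d))  ∎
  where
  open ≤-Reasoning
  join = ⊔-lub (⊓-mono-≤ (m≤m⊔n a c) (m≤m⊔n b d)) (⊓-mono-≤ (m≤n⊔m a c) (m≤n⊔m b d))
  meet = ⊓-glb (⊓-mono-≤ (m⊓n≤m a b) (m⊓n≤m c d)) (⊓-mono-≤ (m⊓n≤n a b) (m⊓n≤n c d))

-- Holds edge by edge. Applied to the two halves of a weight, it passes to `upper` and `lower`,
-- about which the absence of shattering says something.
edges-supermodular : ∀ {n} (u v : Weight n) → edges u + edges v ≤ edges (u ⊔ʷ v) + edges (u ⊓ʷ v)
edges-supermodular {zero}  u v = z≤n
edges-supermodular {suc n} u v = begin
  total (lower u) + (edges u₀ + edges u₁) + (total (lower v) + (edges v₀ + edges v₁))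
    ≡⟨ regroup (total (lower u)) (edges u₀) (edges u₁) _ _ _ ⟩
  (total (lower u) + total (lower v)) + ((edges u₀ + edges v₀) + (edges u₁ + edges v₁))
    ≤⟨ +-mono-≤ lowers (+-mono-≤ (edges-supermodular u₀ v₀) (edges-supermodular u₁ v₁)) ⟩
  (total (lower (u ⊔ʷ v)) + total (lower (u ⊓ʷ v)))
    + ((edges (u₀ ⊔ʷ v₀) + edges (u₀ ⊓ʷ v₀)) + (edges (u₁ ⊔ʷ v₁) + edges (u₁ ⊓ʷ v₁)))
    ≡⟨ regroup (total (lower (u ⊔ʷ v))) (edges (u₀ ⊔ʷ v₀)) (edges (u₁ ⊔ʷ v₁)) _ _ _ ⟨
  edges (u ⊔ʷ v) + edges (u ⊓ʷ v) ∎
  where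
  open ≤-Reasoning
  u₀ = half false u
  u₁ = half true u
  v₀ = half false v
  v₁ = half true v
  regroup : ∀ a b c d e f → a + (b + c) + (d + (e + f)) ≡ (a + d) + ((b + e) + (c + f))
  regroup = solve-∀
  lowers : total (lower u) + total (lower v) ≤ total (lower (u ⊔ʷ v)) + total (lower (u ⊓ʷ v))
  lowers = begin
    total (lower u) + total (lower v)                   ≡⟨ total-+ (lower u) (lower v) ⟨
    total (λ p → lower u p + lower v p)
      ≤⟨ total-mono (λ p → ⊓-supermodular (u₀ p) (u₁ p) (v₀ p) (v₁ p)) ⟩
    total (λ p → lower (u ⊔ʷ v) p + lower (u ⊓ʷ v) p)   ≡⟨ total-+ (lower (u ⊔ʷ v)) (lower (u ⊓ʷ v)) ⟩
    total (lower (u ⊔ʷ v)) + total (lower (u ⊓ʷ v))     ∎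

-- A recursive certificate that the support of a weight shatters k coordinates:
-- the first coordinate is either dropped or belongs to the shattered set.
Shatters : ∀ {n} → ℕ → Weight n → Set
Shatters         zero    w = ∃[ p ] 1 ≤ w p
Shatters {zero}  (suc k) w = ⊥
Shatters {suc n} (suc k) w = Shatters (suc k) (upper w) ⊎ Shatters k (lower w)

¬Shatters-zero : ∀ {n} (w : Weight n) → ¬ Shatters 0 w → ∀ p → w p ≡ 0
¬Shatters-zero w ¬sh p = n<1⇒n≡0 (≰⇒> (λ 1≤wp → ¬sh (p , 1≤wp)))

edges-zero : ∀ {n} (w : Weight n) → (∀ p → w p ≡ 0) → edges w ≡ 0
edges-zero {zero}  w w≡0 = refl
edges-zero {suc n} w w≡0 = cong₂ _+_
  (trans (total-cong (λ p → cong₂ _⊓_ (w≡0 (false ∷ p)) (w≡0 (true ∷ p)))) (total-zero n))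
  (cong₂ _+_ (edges-zero _ (w≡0 ∘ (false ∷_))) (edges-zero _ (w≡0 ∘ (true ∷_))))

total-≡0 : ∀ {n} (w : Weight n) → (∀ p → w p ≡ 0) → total w ≡ 0
total-≡0 {n} w w≡0 = trans (total-cong w≡0) (total-zero n)

-- The density bound for one-inclusion graphs, in weighted form. Edges in the first direction weigh
-- `total (lower w)`; supermodularity moves the others to `upper w` and `lower w`, whose totals add
-- up to `total w`.
edges≤d*total : ∀ d {n} (w : Weight n) → ¬ Shatters (suc d) w → edges w ≤ d * total w
edges≤d*total d {zero}  w ¬sh = z≤n
edges≤d*total d {suc n} w ¬sh = begin
  total (lower w) + (edges (half false w) + edges (half true w))
    ≤⟨ +-monoʳ-≤ (total (lower w)) (edges-supermodular (half false w) (half true w)) ⟩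
  total (lower w) + (edges (upper w) + edges (lower w))
    ≡⟨ regroup (total (lower w)) (edges (upper w)) _ ⟩
  edges (upper w) + (total (lower w) + edges (lower w))
    ≤⟨ +-mono-≤ (edges≤d*total d (upper w) (¬sh ∘ inj₁)) (lower-bound d (¬sh ∘ inj₂)) ⟩
  d * total (upper w) + d * total (lower w)
    ≡⟨ *-distribˡ-+ d (total (upper w)) _ ⟨
  d * (total (upper w) + total (lower w))
    ≡⟨ cong (d *_) (total-upper-lower w) ⟨
  d * total w ∎
  where
  open ≤-Reasoning
  regroup : ∀ a b c → a + (b + c) ≡ b + (a + c)
  regroup = solve-∀
  -- The first coordinate could be added to any set shattered by `lower w`, so the dimension drops
  -- by one here, which pays for the extra `total (lower w)`. At zero not even the empty set is
  -- shattered, and the weight vanishes.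
  lower-bound : ∀ d → ¬ Shatters d (lower w) → total (lower w) + edges (lower w) ≤ d * total (lower w)
  lower-bound zero    ¬sh₀ = ≤-reflexive (cong₂ _+_ (total-≡0 _ vanish) (edges-zero _ vanish))
    where vanish = ¬Shatters-zero (lower w) ¬sh₀
  lower-bound (suc d) ¬sh₀ = +-monoʳ-≤ (total (lower w)) (edges≤d*total d (lower w) ¬sh₀)

-- The usual induction on projection and link, with a power in place of the sum of binomials:
-- m^(d+1) + m^d = (m+1) m^d is at most (m+1)^(d+1).
sauer-shelah : ∀ d {n} (w : Weight n) → (∀ p → w p ≤ 1) → ¬ Shatters (suc d) w → total w ≤ suc n ^ d
sauer-shelah d {zero}  w w≤1 ¬sh = ≤-trans (w≤1 []) (≤-reflexive (sym (^-zeroˡ d)))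
sauer-shelah d {suc n} w w≤1 ¬sh = begin
  total w                            ≡⟨ total-upper-lower w ⟩
  total (upper w) + total (lower w)  ≤⟨ bound d (¬sh ∘ inj₁) (¬sh ∘ inj₂) ⟩
  suc (suc n) ^ d                    ∎
  where
  open ≤-Reasoning
  upper≤1 : ∀ p → upper w p ≤ 1
  upper≤1 p = ⊔-lub (w≤1 _) (w≤1 _)
  lower≤1 : ∀ p → lower w p ≤ 1
  lower≤1 p = ≤-trans (m⊓n≤m _ _) (w≤1 _)
  bound : ∀ d → ¬ Shatters (suc d) (upper w) → ¬ Shatters d (lower w) →
    total (upper w) + total (lower w) ≤ suc (suc n) ^ d
  bound zero    ¬sh₁ ¬sh₀ = ≤-trans
    (+-mono-≤ (sauer-shelah zero (upper w) upper≤1 ¬sh₁)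
              (≤-reflexive (total-≡0 (lower w) (¬Shatters-zero (lower w) ¬sh₀))))
    ≤-refl
  bound (suc d) ¬sh₁ ¬sh₀ = begin
    total (upper w) + total (lower w)
      ≤⟨ +-mono-≤ (sauer-shelah (suc d) (upper w) upper≤1 ¬sh₁) (sauer-shelah d (lower w) lower≤1 ¬sh₀) ⟩
    suc n * suc n ^ d + suc n ^ d   ≡⟨ +-comm (suc n * suc n ^ d) _ ⟩
    suc (suc n) * suc n ^ d         ≤⟨ *-monoʳ-≤ (suc (suc n)) (^-monoˡ-≤ d (n≤1+n (suc n))) ⟩
    suc (suc n) * suc (suc n) ^ d   ∎

-- A maximum is positive because one half is, which tells how to extend a pattern along a dropped
-- coordinate. A minimum is positive only if both halves are, so a coordinate of the shattered set
-- may take either value.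
Shatters⇒coordinates : ∀ k {n} (w : Weight n) → Shatters k w →
  Σ[ a ∈ (Fin k → Fin n) ] ∀ (q : Vec Bool k) → ∃[ p ] (1 ≤ w p × ∀ i → lookup p (a i) ≡ lookup q i)
Shatters⇒coordinates zero    w (p , 1≤wp) = (λ ()) , λ _ → p , 1≤wp , λ ()
Shatters⇒coordinates (suc k) {suc n} w (inj₁ sh)
  with a , shattered ← Shatters⇒coordinates (suc k) (upper w) sh = (suc ∘ a) , extend
  where
  extend : ∀ (q : Vec Bool (suc k)) → ∃[ p ] (1 ≤ w p × ∀ i → lookup p (suc (a i)) ≡ lookup q i)
  extend q with p , pos , agree ← shattered q with ⊔-sel (w (false ∷ p)) (w (true ∷ p))
  ... | inj₁ eq = false ∷ p , ≤-trans pos (≤-reflexive eq) , agree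
  ... | inj₂ eq = true ∷ p , ≤-trans pos (≤-reflexive eq) , agree
Shatters⇒coordinates (suc k) {suc n} w (inj₂ sh)
  with a , shattered ← Shatters⇒coordinates k (lower w) sh =
    lift 1 a , extend
  where
  extend : ∀ (q : Vec Bool (suc k)) → ∃[ p ] (1 ≤ w p × ∀ i → lookup p (lift 1 a i) ≡ lookup q i)
  extend (b ∷ q) with p , pos , agree ← shattered q =
    b ∷ p , positive b , λ { zero → refl ; (suc i) → agree i }
    where
    positive : ∀ b → 1 ≤ w (b ∷ p)
    positive false = ≤-trans pos (m⊓n≤m _ _)
    positive true  = ≤-trans pos (m⊓n≤n _ _)

-- Adjacency patterns of a graph

bit : Fin 2 → Bool
bit zero    = false
bit (suc _) = true

unbit : Bool → Fin 2
unbit false = zero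
unbit true  = suc zero

unbit-bit : ∀ x → unbit (bit x) ≡ x
unbit-bit zero       = refl
unbit-bit (suc zero) = refl

bit-unbit : ∀ b → bit (unbit b) ≡ b
bit-unbit false = refl
bit-unbit true  = refl

funToFin-cong : ∀ {m n} {f g : Fin m → Fin n} → (∀ i → f i ≡ g i) → funToFin f ≡ funToFin g
funToFin-cong {zero}  f≡g = refl
funToFin-cong {suc m} f≡g = cong₂ combine (f≡g zero) (funToFin-cong (f≡g ∘ suc))

-- Binary digits give a concrete bijection to serve as the β of `ContainsUAt`.
pattern-of : ∀ {k} → Fin (2 ^ k) → Subset k
pattern-of j = Vec.tabulate (bit ∘ finToFun j)

pattern-of-bijective : ∀ k → Bijective {A = Fin (2 ^ k)} {B = Subset k} _≡_ _≡_ pattern-of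
pattern-of-bijective k = injective , surjective
  where
  digit : ∀ (j : Fin (2 ^ k)) i → unbit (lookup (pattern-of j) i) ≡ finToFun j i
  digit j i = trans (cong unbit (lookup∘tabulate (bit ∘ finToFun j) i)) (unbit-bit _)
  injective : Injective _≡_ _≡_ pattern-of
  injective {x} {y} eq = trans (sym (funToFin-finToFin {k} {2} x))
    (trans (funToFin-cong (λ i → trans (sym (digit x i)) (trans (cong (λ p → unbit (lookup p i)) eq) (digit y i))))
           (funToFin-finToFin {k} {2} y))
  surjective : ∀ q → ∃[ j ] (∀ {z} → z ≡ j → pattern-of z ≡ q)
  surjective q = funToFin (unbit ∘ lookup q) , λ { refl → trans
    (tabulate-cong (λ i → trans (cong bit (finToFun-funToFin (unbit ∘ lookup q) i)) (bit-unbit _)))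
    (tabulate∘lookup q) }

match : Bool → Bool → ℕ
match false false = 1
match true  true  = 1
match _     _     = 0

match≤1 : ∀ b c → match b c ≤ 1
match≤1 false false = ≤-refl
match≤1 false true  = z≤n
match≤1 true  false = z≤n
match≤1 true  true  = ≤-refl

match-positive : ∀ b c → 1 ≤ match b c → b ≡ c
match-positive false false _ = refl
match-positive true  true  _ = refl

indicator : ∀ {n} → Fin n → Fin n → ℕ
indicator c r = if ⌊ r ≟ c ⌋ then 1 else 0

∑-indicator≤1 : ∀ {n} (c : Fin n) {xs} → Unique xs → ∑ xs (indicator c) ≤ 1
∑-indicator≤1 c [] = z≤n
∑-indicator≤1 c {x ∷ xs} (x∉xs ∷ uniq) with x ≟ c
... | no _     = ∑-indicator≤1 c uniq
... | yes refl = s≤s (≤-reflexive (absent xs x∉xs))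
  where
  absent : ∀ xs → All (c ≢_) xs → ∑ xs (indicator c) ≡ 0
  absent [] [] = refl
  absent (y ∷ ys) (c≢y ∷ rest) with y ≟ c
  ... | yes refl = contradiction refl c≢y
  ... | no _     = absent ys rest

module _ {n : ℕ} (G : Graph n) where

  -- The diagonal is 0 for both bits, so `hit` vanishes at every vertex occurring in the tuple. This
  -- keeps rows and columns of a shattered pattern disjoint.
  entry : Fin n → Fin n → Bool → ℕ
  entry r c b = if ⌊ r ≟ c ⌋ then 0 else match (adj G r c) b

  hit : ∀ {s} → Fin n → Vec (Fin n) s → Weight s
  hit r []      []      = 1
  hit r (c ∷ σ) (b ∷ p) = entry r c b * hit r σ p

  hit-insertAt : ∀ {s} r (τ : Vec (Fin n) s) (p : Vec Bool s) i c b →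
    hit r (insertAt τ i c) (insertAt p i b) ≡ entry r c b * hit r τ p
  hit-insertAt r τ       p        zero    c b = refl
  hit-insertAt r (x ∷ τ) (y ∷ p) (suc i) c b =
    trans (cong (entry r x y *_) (hit-insertAt r τ p i c b)) (swap (entry r x y) (entry r c b) _)
    where
    swap : ∀ a b c → a * (b * c) ≡ b * (a * c)
    swap = solve-∀

  entry-positive : ∀ r c b → 1 ≤ entry r c b → r ≢ c × adj G r c ≡ b
  entry-positive r c b pos with r ≟ c
  ... | no r≢c = r≢c , match-positive (adj G r c) b pos

  entry≤1 : ∀ r c b → entry r c b ≤ 1
  entry≤1 r c b with r ≟ c
  ... | yes _ = z≤n
  ... | no _  = match≤1 (adj G r c) b

  entry-total≤1 : ∀ r c → entry r c false + entry r c true ≤ 1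
  entry-total≤1 r c with r ≟ c | adj G r c
  ... | no _  | true  = s≤s z≤n
  ... | no _  | false = s≤s z≤n
  ... | yes _ | _     = z≤n

  1≤entry-total+indicator : ∀ r c → 1 ≤ entry r c false + entry r c true + indicator c r
  1≤entry-total+indicator r c with r ≟ c | adj G r c
  ... | no _  | true  = s≤s z≤n
  ... | no _  | false = s≤s z≤n
  ... | yes _ | _     = s≤s z≤n

  hit≤1 : ∀ {s} r (σ : Vec (Fin n) s) p → hit r σ p ≤ 1
  hit≤1 r []      []      = ≤-refl
  hit≤1 r (c ∷ σ) (b ∷ p) = *-mono-≤ (entry≤1 r c b) (hit≤1 r σ p)

  hit-positive : ∀ {s} r (σ : Vec (Fin n) s) p → 1 ≤ hit r σ p →
    ∀ i → r ≢ lookup σ i × adj G r (lookup σ i) ≡ lookup p i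
  hit-positive r (c ∷ σ) (b ∷ p) pos i with entry r c b in eq
  hit-positive r (c ∷ σ) (b ∷ p) () i | zero
  hit-positive r (c ∷ σ) (b ∷ p) pos zero    | suc e =
    entry-positive r c b (≤-trans (s≤s z≤n) (≤-reflexive (sym eq)))
  hit-positive r (c ∷ σ) (b ∷ p) pos (suc i) | suc e = hit-positive r σ p
    (n≢0⇒n>0 (λ hit≡0 → 1+n≰n (≤-trans pos (≤-reflexive (trans (cong (suc e *_) hit≡0) (*-zeroʳ e)))))) i

  total-hit : ∀ {s} r c (σ : Vec (Fin n) s) →
    total (hit r (c ∷ σ)) ≡ (entry r c false + entry r c true) * total (hit r σ)
  total-hit r c σ = trans
    (cong₂ _+_ (total-* (entry r c false) (hit r σ)) (total-* (entry r c true) (hit r σ)))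
    (sym (*-distribʳ-+ (total (hit r σ)) (entry r c false) _))

  total-hit≤1 : ∀ {s} r (σ : Vec (Fin n) s) → total (hit r σ) ≤ 1
  total-hit≤1 r []      = ≤-refl
  total-hit≤1 r (c ∷ σ) = ≤-trans (≤-reflexive (total-hit r c σ))
    (*-mono-≤ (entry-total≤1 r c) (total-hit≤1 r σ))

  total-hit-step : ∀ {s} r c (σ : Vec (Fin n) s) →
    total (hit r σ) ≤ total (hit r (c ∷ σ)) + indicator c r
  total-hit-step r c σ = begin
    h                        ≡⟨ *-identityˡ h ⟨
    1 * h                    ≤⟨ *-monoˡ-≤ h (1≤entry-total+indicator r c) ⟩
    (e + indicator c r) * h  ≡⟨ *-distribʳ-+ h e _ ⟩
    e * h + indicator c r * h
      ≤⟨ +-mono-≤ (≤-reflexive (sym (total-hit r c σ))) (*-monoʳ-≤ (indicator c r) (total-hit≤1 r σ)) ⟩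
    total (hit r (c ∷ σ)) + indicator c r * 1  ≡⟨ cong (total (hit r (c ∷ σ)) +_) (*-identityʳ _) ⟩
    total (hit r (c ∷ σ)) + indicator c r      ∎
    where
    open ≤-Reasoning
    h = total (hit r σ)
    e = entry r c false + entry r c true

  classes : ∀ {s} → Vec (Fin n) s → Weight s
  classes σ p = ∑ (allFin n) (λ r → hit r σ p)

  total-classes : ∀ {s} (σ : Vec (Fin n) s) → total (classes σ) ≡ ∑ (allFin n) (λ r → total (hit r σ))
  total-classes σ = total-∑ (allFin n) (λ r → hit r σ)

  total-classes≤n : ∀ {s} (σ : Vec (Fin n) s) → total (classes σ) ≤ n
  total-classes≤n σ = begin
    total (classes σ)                          ≡⟨ total-classes σ ⟩
    ∑ (allFin n) (λ r → total (hit r σ))       ≤⟨ ∑-mono (allFin n) (λ r → total-hit≤1 r σ) ⟩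
    ∑ (allFin n) (λ _ → 1)                     ≡⟨ ∑-const (allFin n) 1 ⟩
    length (allFin n) * 1                      ≡⟨ *-identityʳ _ ⟩
    length (allFin n)                          ≡⟨ length-allFin n ⟩
    n                                          ∎
    where open ≤-Reasoning

  -- Extending the tuple by `c` removes at most the vertex `c` from the classes.
  n≤total-classes+s : ∀ {s} (σ : Vec (Fin n) s) → n ≤ total (classes σ) + s
  n≤total-classes+s [] = begin
    n                                   ≡⟨ length-allFin n ⟨
    length (allFin n)                   ≡⟨ *-identityʳ _ ⟨
    length (allFin n) * 1               ≡⟨ ∑-const (allFin n) 1 ⟨
    ∑ (allFin n) (λ _ → 1)              ≡⟨ +-identityʳ _ ⟨
    total (classes []) + 0            ∎
    where open ≤-Reasoning
  n≤total-classes+s {suc s} (c ∷ σ) = begin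
    n                                   ≤⟨ n≤total-classes+s σ ⟩
    total (classes σ) + s             ≡⟨ cong (_+ s) (total-classes σ) ⟩
    ∑ (allFin n) (λ r → total (hit r σ)) + s
      ≤⟨ +-monoˡ-≤ s (∑-mono (allFin n) (λ r → total-hit-step r c σ)) ⟩
    ∑ (allFin n) (λ r → total (hit r (c ∷ σ)) + indicator c r) + s
      ≡⟨ cong (_+ s) (∑-+ (allFin n) _ _) ⟩
    ∑ (allFin n) (λ r → total (hit r (c ∷ σ))) + ∑ (allFin n) (indicator c) + s
      ≤⟨ +-monoˡ-≤ s (+-mono-≤ (≤-reflexive (sym (total-classes (c ∷ σ)))) (∑-indicator≤1 c (allFin⁺ n))) ⟩
    total (classes (c ∷ σ)) + 1 + s   ≡⟨ +-assoc (total (classes (c ∷ σ))) 1 s ⟩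
    total (classes (c ∷ σ)) + suc s   ∎
    where open ≤-Reasoning

  classes-positive : ∀ {s} (σ : Vec (Fin n) s) p → 1 ≤ classes σ p → ∃[ r ] 1 ≤ hit r σ p
  classes-positive σ p = go (allFin n)
    where
    go : ∀ xs → 1 ≤ ∑ xs (λ r → hit r σ p) → ∃[ r ] 1 ≤ hit r σ p
    go (x ∷ xs) pos with hit x σ p in eq
    ... | zero  = go xs pos
    ... | suc _ = x , ≤-trans (s≤s z≤n) (≤-reflexive (sym eq))

  -- Shattered coordinates and one row for each pattern on them form a copy of U(k). Allowing any
  -- `w` below `classes` covers both the class sizes and the indicator of the nonempty classes.
  UFree⇒¬Shatters : ∀ {k s} → UFree k G → (σ : Vec (Fin n) s) (w : Weight s) →
    (∀ p → w p ≤ classes σ p) → ¬ Shatters k w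
  UFree⇒¬Shatters {k} free σ w w≤ sh with a , shattered ← Shatters⇒coordinates k w sh =
    free α (proj₁ ∘ row) α-injective b-injective (λ i j eq → proj₁ (proj₂ (row j) i) (sym eq))
      (pattern-of , pattern-of-bijective k , λ i j → trans (adj-sym G _ _) (proj₂ (proj₂ (row j) i)))
    where
    α : Fin k → Fin n
    α i = lookup σ (a i)
    rowOf : ∀ q → Σ[ r ∈ Fin n ] (∀ i → r ≢ α i × adj G r (α i) ≡ lookup q i)
    rowOf q with p , pos , agree ← shattered q
            with r , hits ← classes-positive σ p (≤-trans pos (w≤ p)) =
      r , λ i → proj₁ (hit-positive r σ p hits (a i))
              , trans (proj₂ (hit-positive r σ p hits (a i))) (agree i)
    row : ∀ j → Σ[ r ∈ Fin n ] (∀ i → r ≢ α i × adj G r (α i) ≡ lookup (pattern-of j) i)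
    row j = rowOf (pattern-of j)
    α-injective : Injective _≡_ _≡_ α
    α-injective {x} {y} eq with x ≟ y
    ... | yes x≡y = x≡y
    ... | no  x≢y = contradiction
      (trans (sym (singleton x)) (trans (cong (adj G r) eq) (singleton y)))
      λ true≡ → x≢y (equal true≡)
      where
      q : Subset k
      -- A row with the singleton pattern of `x` is adjacent to column `x` but not to column `y` for
      -- any other index `y`, so the two columns cannot coincide.
      q = Vec.tabulate (λ i → ⌊ x ≟ i ⌋)
      r = proj₁ (rowOf q)
      singleton : ∀ i → adj G r (α i) ≡ ⌊ x ≟ i ⌋
      singleton i = trans (proj₂ (proj₂ (rowOf q) i)) (lookup∘tabulate _ i)
      equal : ⌊ x ≟ x ⌋ ≡ ⌊ x ≟ y ⌋ → x ≡ y
      equal eq′ with x ≟ y | x ≟ x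
      ... | yes x≡y | _      = x≡y
      ... | no _    | no x≢x = contradiction refl x≢x
      equal () | no _ | yes _
    b-injective : Injective _≡_ _≡_ (proj₁ ∘ row)
    b-injective {x} {y} eq = proj₁ (pattern-of-bijective k)
      (trans (sym (tabulate∘lookup _)) (trans (tabulate-cong same) (tabulate∘lookup _)))
      where
      same : ∀ i → lookup (pattern-of x) i ≡ lookup (pattern-of y) i
      same i = trans (sym (proj₂ (proj₂ (row x) i)))
                     (trans (cong (λ r → adj G r (α i)) eq) (proj₂ (proj₂ (row y) i)))

-- Packing

-- The remainder is written `1 ⊓ n` so that empty classes contribute nothing: summed over all
-- patterns it is the number of nonempty classes, which `sauer-shelah` bounds.
n≤⌊n/2⌋*2+1⊓n : ∀ n → n ≤ ⌊ n /2⌋ * 2 + 1 ⊓ n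
n≤⌊n/2⌋*2+1⊓n zero          = z≤n
n≤⌊n/2⌋*2+1⊓n (suc zero)    = ≤-refl
n≤⌊n/2⌋*2+1⊓n (suc (suc n)) = s≤s (s≤s (≤-trans (n≤⌊n/2⌋*2+1⊓n n) (+-monoʳ-≤ (⌊ n /2⌋ * 2) (⊓-monoʳ-≤ 1 (m≤n+m n 2)))))

module _ {n : ℕ} (G : Graph n) where

  -- Since `entry` is 0 on the diagonal, neither `u` nor `v` counts: `distance` is the size of the
  -- symmetric difference of the two neighbourhoods outside these vertices.
  separates : Fin n → Fin n → Fin n → ℕ
  separates u v c = entry G u c false * entry G v c true + entry G u c true * entry G v c false

  distance : Fin n → Fin n → ℕ
  distance u v = ∑ (allFin n) (separates u v)

  -- The largest number of disjoint pairs of vertices outside `τ` such that the two members of a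
  -- pair have the same pattern on `τ`.
  pairs : ∀ {s} → Vec (Fin n) s → ℕ
  pairs τ = total (λ p → ⌊ classes G τ p /2⌋)

  module _ (k : ℕ) (apart : ∀ u v → u ≢ v → k ≤ distance u v) where

    -- Pairing up the members of a class, a vertex separating j of the pairs
    -- splits the class into two parts of size at least j each.
    ⌊class/2⌋*k≤∑minority : ∀ {xs} → Unique xs → ⌊ length xs /2⌋ * k ≤
      ∑ (allFin n) (λ c → ∑ xs (λ r → entry G r c false) ⊓ ∑ xs (λ r → entry G r c true))
    ⌊class/2⌋*k≤∑minority []       = z≤n
    ⌊class/2⌋*k≤∑minority (_ ∷ []) = z≤n
    ⌊class/2⌋*k≤∑minority {u ∷ v ∷ xs} ((u≢v ∷ _) ∷ _ ∷ uniq) = begin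
      k + ⌊ length xs /2⌋ * k
        ≤⟨ +-mono-≤ (apart u v u≢v) (⌊class/2⌋*k≤∑minority uniq) ⟩
      distance u v + ∑ (allFin n) (λ c → ∑ xs (λ r → entry G r c false) ⊓ ∑ xs (λ r → entry G r c true))
        ≡⟨ ∑-+ (allFin n) _ _ ⟨
      ∑ (allFin n) (λ c → separates u v c + (∑ xs (λ r → entry G r c false) ⊓ ∑ xs (λ r → entry G r c true)))
        ≤⟨ ∑-mono (allFin n) (λ c → ⊓-glb
             (split (entry G u c false) (entry G v c false) (sepᶠ c) (m⊓n≤m (∑ xs (λ r → entry G r c false)) _))
             (split (entry G u c true) (entry G v c true) (sepᵗ c) (m⊓n≤n (∑ xs (λ r → entry G r c false)) _))) ⟩
      ∑ (allFin n) (λ c → ∑ (u ∷ v ∷ xs) (λ r → entry G r c false) ⊓ ∑ (u ∷ v ∷ xs) (λ r → entry G r c true)) ∎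
      where
      open ≤-Reasoning
      sepᶠ : ∀ c → separates u v c ≤ entry G u c false + entry G v c false
      sepᶠ c = +-mono-≤
        (≤-trans (*-monoʳ-≤ (entry G u c false) (entry≤1 G v c true)) (≤-reflexive (*-identityʳ _)))
        (≤-trans (*-monoˡ-≤ (entry G v c false) (entry≤1 G u c true)) (≤-reflexive (*-identityˡ _)))
      sepᵗ : ∀ c → separates u v c ≤ entry G u c true + entry G v c true
      sepᵗ c = ≤-trans (+-mono-≤
        (≤-trans (*-monoˡ-≤ (entry G v c true) (entry≤1 G u c false)) (≤-reflexive (*-identityˡ _)))
        (≤-trans (*-monoʳ-≤ (entry G u c true) (entry≤1 G v c false)) (≤-reflexive (*-identityʳ _))))
        (≤-reflexive (+-comm (entry G v c true) _))
      split : ∀ {a d e} b c → a ≤ b + c → d ≤ e → a + d ≤ b + (c + e)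
      split b c a≤b+c d≤e = ≤-trans (+-mono-≤ a≤b+c d≤e) (≤-reflexive (+-assoc b c _))

    -- Inserting `c` splits each class of `τ` in two, and the smaller part is the weight of an edge
    -- in direction `i`. The bound for a single class is then summed over all classes.
    pairs*k≤∑edgesAt : ∀ {s} (τ : Vec (Fin n) s) i →
      pairs τ * k ≤ ∑ (allFin n) (λ c → edgesAt i (classes G (insertAt τ i c)))
    pairs*k≤∑edgesAt {s} τ i = begin
      pairs τ * k                                ≡⟨ *-comm (pairs τ) k ⟩
      k * pairs τ                                ≡⟨ total-* k (λ p → ⌊ classes G τ p /2⌋) ⟨
      total (λ p → k * ⌊ classes G τ p /2⌋)      ≤⟨ total-mono class-bound ⟩
      total (λ p → ∑ (allFin n) (λ c → minority c p))
        ≡⟨ total-∑ (allFin n) minority ⟩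
      ∑ (allFin n) (λ c → total (minority c))
        ≡⟨ ∑-cong (allFin n) (λ c → sym (edgesAt-insertAt i (classes G (insertAt τ i c)))) ⟩
      ∑ (allFin n) (λ c → edgesAt i (classes G (insertAt τ i c))) ∎
      where
      open ≤-Reasoning
      minority : Fin n → Weight s
      minority c p = classes G (insertAt τ i c) (insertAt p i false) ⊓ classes G (insertAt τ i c) (insertAt p i true)
      members : Vec Bool s → List (Fin n)
      members p = filter (λ r → hit G r τ p ℕ.≟ 1) (allFin n)
      classes-insertAt : ∀ p c b →
        classes G (insertAt τ i c) (insertAt p i b) ≡ ∑ (members p) (λ r → entry G r c b)
      classes-insertAt p c b = trans
        (∑-cong (allFin n) (λ r → hit-insertAt G r τ p i c b))
        (∑-filter (allFin n) (λ r → entry G r c b) (λ r → hit G r τ p) (λ r → hit≤1 G r τ p))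
      classes-length : ∀ p → classes G τ p ≡ length (members p)
      classes-length p = begin-equality
        ∑ (allFin n) (λ r → hit G r τ p)      ≡⟨ ∑-cong (allFin n) (λ r → sym (*-identityˡ _)) ⟩
        ∑ (allFin n) (λ r → 1 * hit G r τ p)  ≡⟨ ∑-filter (allFin n) (λ _ → 1) _ (λ r → hit≤1 G r τ p) ⟩
        ∑ (members p) (λ _ → 1)               ≡⟨ ∑-const (members p) 1 ⟩
        length (members p) * 1                ≡⟨ *-identityʳ _ ⟩
        length (members p)                    ∎
      class-bound : ∀ p → k * ⌊ classes G τ p /2⌋ ≤ ∑ (allFin n) (λ c → minority c p)
      class-bound p = begin
        k * ⌊ classes G τ p /2⌋      ≡⟨ *-comm k _ ⟩
        ⌊ classes G τ p /2⌋ * k      ≡⟨ cong (λ m → ⌊ m /2⌋ * k) (classes-length p) ⟩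
        ⌊ length (members p) /2⌋ * k ≤⟨ ⌊class/2⌋*k≤∑minority (filter⁺ (λ r → hit G r τ p ℕ.≟ 1) (allFin⁺ n)) ⟩
        ∑ (allFin n) (λ c → ∑ (members p) (λ r → entry G r c false) ⊓ ∑ (members p) (λ r → entry G r c true))
          ≡⟨ ∑-cong (allFin n) (λ c → sym (cong₂ _⊓_ (classes-insertAt p c false) (classes-insertAt p c true))) ⟩
        ∑ (allFin n) (λ c → minority c p) ∎

    module _ {d : ℕ} (free : UFree (suc d) G) where

      -- Unpaired vertices are the at most `s` entries of the tuple and at most one vertex from each
      -- nonempty class.
      n≤pairs*2+rest : ∀ {s} (τ : Vec (Fin n) s) → n ≤ pairs τ * 2 + (suc s ^ d + s)
      n≤pairs*2+rest {s} τ = begin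
        n                         ≤⟨ n≤total-classes+s G τ ⟩
        total (classes G τ) + s   ≤⟨ +-monoˡ-≤ s (total-mono (λ p → n≤⌊n/2⌋*2+1⊓n (classes G τ p))) ⟩
        total (λ p → ⌊ classes G τ p /2⌋ * 2 + 1 ⊓ classes G τ p) + s
          ≡⟨ cong (_+ s) (total-+ _ (λ p → 1 ⊓ classes G τ p)) ⟩
        total (λ p → ⌊ classes G τ p /2⌋ * 2) + total (λ p → 1 ⊓ classes G τ p) + s
          ≤⟨ +-monoˡ-≤ s (+-mono-≤ (≤-reflexive doubled) (sauer-shelah d _ (λ p → m⊓n≤m 1 _)
               (UFree⇒¬Shatters G free τ _ (λ p → m⊓n≤n 1 _)))) ⟩
        pairs τ * 2 + suc s ^ d + s    ≡⟨ +-assoc (pairs τ * 2) _ s ⟩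
        pairs τ * 2 + (suc s ^ d + s)  ∎
        where
        open ≤-Reasoning
        doubled : total (λ p → ⌊ classes G τ p /2⌋ * 2) ≡ pairs τ * 2
        doubled = trans (total-cong (λ p → *-comm ⌊ classes G τ p /2⌋ 2)) (trans (total-* 2 (λ p → ⌊ classes G τ p /2⌋)) (*-comm 2 (pairs τ)))

      -- Double counting of the one-inclusion edges over all (s + 1)-tuples of vertices.
      haussler-packing : ∀ s → 2 * (suc s ^ d + s) ≤ n → suc s * k ≤ 4 * (d * n)
      haussler-packing s large = *-cancelˡ-≤ (n ^ suc s) {{m^n≢0 n (suc s) {{n≢0}}}} (begin
        n ^ suc s * (suc s * k)                      ≡⟨ regroup n (n ^ s) (suc s) k ⟩
        suc s * (n ^ s * (n * k))                    ≡⟨ cong (suc s *_) (∑ⱽ-const s (n * k)) ⟨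
        suc s * ∑ⱽ {n} s (λ _ → n * k)               ≡⟨ cong (_* ∑ⱽ {n} s (λ _ → n * k)) (length-allFin (suc s)) ⟨
        length (allFin (suc s)) * ∑ⱽ {n} s (λ _ → n * k)
          ≡⟨ ∑-const (allFin (suc s)) _ ⟨
        ∑ (allFin (suc s)) (λ i → ∑ⱽ s (λ _ → n * k))
          ≤⟨ ∑-mono (allFin (suc s)) (λ i → ∑ⱽ-mono s (λ τ → direction i τ)) ⟩
        ∑ (allFin (suc s)) (λ i → ∑ⱽ s (λ τ → ∑ (allFin n) (λ c → 4 * edgesAt i (classes G (insertAt τ i c)))))
          ≡⟨ ∑-cong (allFin (suc s)) (λ i → sym (∑ⱽ-insertAt s i (λ σ → 4 * edgesAt i (classes G σ)))) ⟩
        ∑ (allFin (suc s)) (λ i → ∑ⱽ (suc s) (λ σ → 4 * edgesAt i (classes G σ)))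
          ≡⟨ ∑-∑ⱽ-swap (allFin (suc s)) (suc s) (λ i σ → 4 * edgesAt i (classes G σ)) ⟩
        ∑ⱽ (suc s) (λ σ → ∑ (allFin (suc s)) (λ i → 4 * edgesAt i (classes G σ)))
          ≤⟨ ∑ⱽ-mono (suc s) all-directions ⟩
        ∑ⱽ {n} (suc s) (λ _ → 4 * (d * n))           ≡⟨ ∑ⱽ-const {n} (suc s) (4 * (d * n)) ⟩
        n ^ suc s * (4 * (d * n))                    ∎)
        where
        open ≤-Reasoning
        n≢0 : NonZero n
        n≢0 = >-nonZero (≤-trans (≤-trans (m^n>0 (suc s) d) (m≤m+n _ s)) (≤-trans (m≤m+n _ _) large))
        regroup : ∀ a b c e → a * b * (c * e) ≡ c * (b * (a * e))
        regroup = solve-∀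
        -- By `large` at most half of the vertices stay unpaired, so twice the number of pairs is at
        -- least n / 2.
        n≤4*pairs : ∀ (τ : Vec (Fin n) s) → n ≤ 4 * pairs τ
        n≤4*pairs τ = +-cancelʳ-≤ n n _ (begin
          n + n                                        ≡⟨ cong (n +_) (+-identityʳ n) ⟨
          2 * n                                        ≤⟨ *-monoʳ-≤ 2 (n≤pairs*2+rest τ) ⟩
          2 * (pairs τ * 2 + (suc s ^ d + s))          ≡⟨ expand (pairs τ) _ ⟩
          4 * pairs τ + 2 * (suc s ^ d + s)            ≤⟨ +-monoʳ-≤ (4 * pairs τ) large ⟩
          4 * pairs τ + n                              ∎)
          where
          expand : ∀ a b → 2 * (a * 2 + b) ≡ 4 * a + 2 * b
          expand = solve-∀
        direction : ∀ i τ → n * k ≤ ∑ (allFin n) (λ c → 4 * edgesAt i (classes G (insertAt τ i c)))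
        direction i τ = begin
          n * k                ≤⟨ *-monoˡ-≤ k (n≤4*pairs τ) ⟩
          4 * pairs τ * k      ≡⟨ *-assoc 4 (pairs τ) k ⟩
          4 * (pairs τ * k)    ≤⟨ *-monoʳ-≤ 4 (pairs*k≤∑edgesAt τ i) ⟩
          4 * ∑ (allFin n) (λ c → edgesAt i (classes G (insertAt τ i c)))  ≡⟨ ∑-* 4 (allFin n) _ ⟨
          ∑ (allFin n) (λ c → 4 * edgesAt i (classes G (insertAt τ i c)))  ∎
        all-directions : ∀ (σ : Vec (Fin n) (suc s)) →
          ∑ (allFin (suc s)) (λ i → 4 * edgesAt i (classes G σ)) ≤ 4 * (d * n)
        all-directions σ = begin
          ∑ (allFin (suc s)) (λ i → 4 * edgesAt i (classes G σ))  ≡⟨ ∑-* 4 (allFin (suc s)) (λ i → edgesAt i (classes G σ)) ⟩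
          4 * ∑ (allFin (suc s)) (λ i → edgesAt i (classes G σ))  ≡⟨ cong (4 *_) (edges-∑ (classes G σ)) ⟨
          4 * edges (classes G σ)
            ≤⟨ *-monoʳ-≤ 4 (edges≤d*total d (classes G σ) (UFree⇒¬Shatters G free σ (classes G σ) (λ _ → ≤-refl))) ⟩
          4 * (d * total (classes G σ))  ≤⟨ *-monoʳ-≤ 4 (*-monoʳ-≤ d (total-classes≤n G σ)) ⟩
          4 * (d * n)                    ∎

  -- A finite search over all pairs. If it fails, distinct vertices are at distance at least
  -- `suc K`, contradicting the packing bound.
  close-pair : ∀ {d} → UFree (suc d) G → ∀ s K → 2 * (suc s ^ d + s) ≤ n → 4 * (d * n) < suc s * suc K →
    ∃[ u ] ∃[ v ] (u ≢ v × distance u v ≤ K)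
  close-pair free s K large small
    with any? (λ u → any? (λ v → ¬? (u ≟ v) ×-dec (distance u v ≤? K)))
  ... | yes found = found
  ... | no none = contradiction
    (haussler-packing (suc K) (λ u v u≢v → ≰⇒> (λ near → none (u , v , u≢v , near))) free s large)
    (<⇒≱ small)

separates≤1 : ∀ {n} (G : Graph n) u v c → separates G u v c ≤ 1
separates≤1 G u v c = begin
  entry G u c false * entry G v c true + entry G u c true * entry G v c false
    ≤⟨ +-mono-≤ (*-monoʳ-≤ (entry G u c false) (entry≤1 G v c true))
                (*-monoʳ-≤ (entry G u c true) (entry≤1 G v c false)) ⟩
  entry G u c false * 1 + entry G u c true * 1
    ≡⟨ cong₂ _+_ (*-identityʳ (entry G u c false)) (*-identityʳ (entry G u c true)) ⟩
  entry G u c false + entry G u c true  ≤⟨ entry-total≤1 G u c ⟩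
  1                                     ∎
  where open ≤-Reasoning

distance≤n : ∀ {n} (G : Graph n) u v → distance G u v ≤ n
distance≤n {n} G u v = begin
  distance G u v          ≤⟨ ∑-mono (allFin n) (separates≤1 G u v) ⟩
  ∑ (allFin n) (λ _ → 1)  ≡⟨ ∑-const (allFin n) 1 ⟩
  length (allFin n) * 1   ≡⟨ *-identityʳ _ ⟩
  length (allFin n)       ≡⟨ length-allFin n ⟩
  n                       ∎
  where open ≤-Reasoning

-- Encoding graphs by deleting near-twins

length-cartesianProductWith : ∀ {A B C : Set} (f : A → B → C) xs ys →
  length (cartesianProductWith f xs ys) ≡ length xs * length ys
length-cartesianProductWith f []       ys = refl
length-cartesianProductWith f (x ∷ xs) ys = trans (length-++ (map (f x) ys))
  (cong₂ _+_ (length-map (f x) ys) (length-cartesianProductWith f xs ys))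

words : ∀ {A : Set} → ℕ → List A → List (List A)
words zero    xs = [] ∷ []
words (suc k) xs = cartesianProductWith _∷_ xs (words k xs)

length-words : ∀ {A : Set} k (xs : List A) → length (words k xs) ≡ length xs ^ k
length-words zero    xs = refl
length-words (suc k) xs = trans (length-cartesianProductWith _∷_ xs (words k xs))
  (cong (length xs *_) (length-words k xs))

∈-words : ∀ {A : Set} (xs : List A) → (∀ a → a ∈ xs) → ∀ ys → ys ∈ words (length ys) xs
∈-words xs complete []       = here refl
∈-words xs complete (y ∷ ys) = ∈-cartesianProductWith⁺ _∷_ (complete y) (∈-words xs complete ys)

AllPairs-lookup : ∀ {A : Set} {R : A → A → Set} {xs} → AllPairs R xs →
  ∀ {i j} → i Fin.< j → R (List.lookup xs i) (List.lookup xs j)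
AllPairs-lookup (all ∷ _)   {zero}  {suc j} _         = All.lookup all (∈-lookup j)
AllPairs-lookup (_ ∷ pairs) {suc i} {suc j} (s≤s i<j) = AllPairs-lookup pairs i<j

-- By pigeonhole a longer list would contain two related entries with the same code. Only `R`
-- matters, so graphs can be compared pointwise rather than by equality.
length≤length-of-cover : ∀ {A B : Set} {R : A → A → Set} (_represents_ : B → A → Set) →
  (∀ {b x y} → b represents x → b represents y → ¬ R x y) →
  ∀ bs {xs} → AllPairs R xs → All (λ x → ∃[ b ] (b ∈ bs × b represents x)) xs → length xs ≤ length bs
length≤length-of-cover _represents_ clash bs {xs} related covered = ≮⇒≥ impossible
  where
  cover : ∀ i → ∃[ b ] (b ∈ bs × b represents (List.lookup xs i))
  cover i = All.lookup covered (∈-lookup i)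
  code : Fin (length xs) → Fin (length bs)
  code i = index (proj₁ (proj₂ (cover i)))
  represents-code : ∀ i → List.lookup bs (code i) represents List.lookup xs i
  represents-code i with b , b∈bs , rep ← cover i = subst (_represents List.lookup xs i) (lookup-index b∈bs) rep
  impossible : ¬ (length bs < length xs)
  impossible bs<xs with i , j , i<j , same ← pigeonhole bs<xs code =
    clash (represents-code i) (subst (λ c → List.lookup bs c represents List.lookup xs j) (sym same) (represents-code j))
      (AllPairs-lookup related i<j)

-- Rebuilding a graph from a vertex-deleted subgraph

Matrix : ℕ → Set
Matrix n = Fin n → Fin n → Bool

_∈ᵇ_ : ∀ {n} → Fin n → List (Fin n) → Bool
x ∈ᵇ ys = ⌊ DecMembership._∈?_ _≟_ x ys ⌋

-- The row of `u` is the row of its twin `v` flipped on `ys`. Here `v` is named in the smaller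
-- vertex set and `ys` in the larger one.
newRow : ∀ {n} → Matrix n → Fin (suc n) → Fin n → List (Fin (suc n)) → Fin n → Bool
newRow g u v ys j = g v j xor (punchIn u j ∈ᵇ ys)

oldRows : ∀ {n} → Matrix n → Fin (suc n) → Fin n → List (Fin (suc n)) → Fin n → Fin (suc n) → Bool
oldRows g u v ys i = insertAtᶠ (g i) u (newRow g u v ys i)

extend : ∀ {n} → Matrix n → Fin (suc n) → Fin n → List (Fin (suc n)) → Matrix (suc n)
extend g u v ys = insertAtᶠ (oldRows g u v ys) u (insertAtᶠ (newRow g u v ys) u false)

deleteVertex : ∀ {n} → Graph (suc n) → Fin (suc n) → Graph n
deleteVertex G u = record
  { adj    = λ i j → adj G (punchIn u i) (punchIn u j)
  ; sym    = λ i j → adj-sym G _ _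
  ; irrefl = λ i → irrefl G _
  }

deleteVertex-UFree : ∀ {n k} (G : Graph (suc n)) u → UFree k G → UFree k (deleteVertex G u)
deleteVertex-UFree G u free a b a-inj b-inj a≢b (β , bij , edge) =
  free (punchIn u ∘ a) (punchIn u ∘ b)
    (a-inj ∘ punchIn-injective u _ _) (b-inj ∘ punchIn-injective u _ _)
    (λ i j → a≢b i j ∘ punchIn-injective u _ _) (β , bij , edge)

xor-differ : ∀ {P : Set} (P? : Dec P) a b → (P → a ≢ b) → (a ≢ b → P) → b xor ⌊ P? ⌋ ≡ a
xor-differ (yes p) false false P⇒≢ _ = contradiction refl (P⇒≢ p)
xor-differ (yes p) false true  _   _ = refl
xor-differ (yes p) true  false _   _ = refl
xor-differ (yes p) true  true  P⇒≢ _ = contradiction refl (P⇒≢ p)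
xor-differ (no ¬p) false false _   _ = refl
xor-differ (no ¬p) false true  _ ≢⇒P = contradiction (≢⇒P λ ()) ¬p
xor-differ (no ¬p) true  false _ ≢⇒P = contradiction (≢⇒P λ ()) ¬p
xor-differ (no ¬p) true  true  _   _ = refl

data PunchView {n} (u : Fin (suc n)) : Fin (suc n) → Set where
  hole  : PunchView u u
  other : ∀ j → PunchView u (punchIn u j)

punchView : ∀ {n} (u i : Fin (suc n)) → PunchView u i
punchView u i with u ≟ i
... | yes refl = hole
... | no  u≢i  = subst (PunchView u) (punchIn-punchOut u≢i) (other (punchOut u≢i))

module _ {n : ℕ} (G : Graph (suc n)) (u : Fin (suc n)) (v : Fin n) where

  Differ : Fin (suc n) → Set
  Differ j = j ≢ u × adj G u j ≢ adj G (punchIn u v) j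

  differ? : Decidable Differ
  differ? j = ¬? (j ≟ u) ×-dec ¬? (adj G u j Bool.≟ adj G (punchIn u v) j)

  differences : List (Fin (suc n))
  differences = filter differ? (allFin (suc n))

  -- The extra one is for the twin itself: `distance` ignores it, but the rows differ there when the
  -- twins are adjacent.
  length-differences : length differences ≤ suc (distance G u (punchIn u v))
  length-differences = begin
    length differences
      ≤⟨ length-filter≤∑ differ? (λ j → separates G u w j + indicator w j) counted (allFin (suc n)) ⟩
    ∑ (allFin (suc n)) (λ j → separates G u w j + indicator w j)
      ≡⟨ ∑-+ (allFin (suc n)) (separates G u w) (indicator w) ⟩
    distance G u w + ∑ (allFin (suc n)) (indicator w)
      ≤⟨ +-monoʳ-≤ (distance G u w) (∑-indicator≤1 w (allFin⁺ (suc n))) ⟩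
    distance G u w + 1    ≡⟨ +-comm (distance G u w) 1 ⟩
    suc (distance G u w)  ∎
    where
    open ≤-Reasoning
    w = punchIn u v
    counted : ∀ j → Differ j → 1 ≤ separates G u w j + indicator w j
    counted j (j≢u , differ) with u ≟ j | w ≟ j | j ≟ w
    ... | yes u≡j | _       | _        = contradiction (sym u≡j) j≢u
    ... | no _    | yes w≡j | no j≢w   = contradiction (sym w≡j) j≢w
    ... | no _    | _       | yes _    = m≤n+m 1 _
    ... | no _    | no _    | no _ with adj G u j | adj G w j
    ...   | false | false = contradiction refl differ
    ...   | false | true  = ≤-refl
    ...   | true  | false = ≤-refl
    ...   | true  | true  = contradiction refl differ

  module _ (g : Matrix n) (g≡G : ∀ i j → g i j ≡ adj (deleteVertex G u) i j)
           (ys : List (Fin (suc n))) (ys-complete : ∀ j → Differ j → j ∈ ys)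
           (ys-sound : ∀ j → j ∈ ys → j ≢ u → Differ j) where

    row-correct : ∀ j → newRow g u v ys j ≡ adj G u (punchIn u j)
    row-correct j = trans (cong (_xor (punchIn u j ∈ᵇ ys)) (g≡G v j))
      (xor-differ _ _ _ (λ j∈ys → proj₂ (ys-sound _ j∈ys (punchInᵢ≢i u j)))
                        (λ differ → ys-complete _ (punchInᵢ≢i u j , differ)))

    extend-correct : ∀ i j → extend g u v ys i j ≡ adj G i j
    extend-correct i j with punchView u i | punchView u j
    ... | hole    | hole    = begin
      extend g u v ys u u                    ≡⟨ cong-app (insertAt-lookup (oldRows g u v ys) u _) u ⟩
      insertAtᶠ (newRow g u v ys) u false u  ≡⟨ insertAt-lookup (newRow g u v ys) u false ⟩
      false                                  ≡⟨ irrefl G u ⟨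
      adj G u u                              ∎
      where open ≡-Reasoning
    ... | hole    | other y = begin
      extend g u v ys u (punchIn u y)
        ≡⟨ cong-app (insertAt-lookup (oldRows g u v ys) u _) (punchIn u y) ⟩
      insertAtᶠ (newRow g u v ys) u false (punchIn u y)
        ≡⟨ insertAt-punchIn (newRow g u v ys) u false y ⟩
      newRow g u v ys y                      ≡⟨ row-correct y ⟩
      adj G u (punchIn u y)                  ∎
      where open ≡-Reasoning
    ... | other x | hole    = begin
      extend g u v ys (punchIn u x) u
        ≡⟨ cong-app (insertAt-punchIn (oldRows g u v ys) u _ x) u ⟩
      oldRows g u v ys x u                   ≡⟨ insertAt-lookup (g x) u _ ⟩
      newRow g u v ys x                      ≡⟨ row-correct x ⟩
      adj G u (punchIn u x)                  ≡⟨ adj-sym G u (punchIn u x) ⟩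
      adj G (punchIn u x) u                  ∎
      where open ≡-Reasoning
    ... | other x | other y = begin
      extend g u v ys (punchIn u x) (punchIn u y)
        ≡⟨ cong-app (insertAt-punchIn (oldRows g u v ys) u _ x) (punchIn u y) ⟩
      oldRows g u v ys x (punchIn u y)       ≡⟨ insertAt-punchIn (g x) u _ y ⟩
      g x y                                  ≡⟨ g≡G x y ⟩
      adj G (punchIn u x) (punchIn u y)      ∎
      where open ≡-Reasoning

  -- The list is padded with u, whose membership is never queried by extend.
  paddedDifferences : ∀ k → length differences ≤ k →
    ∃[ ys ] (length ys ≡ k × (∀ j → Differ j → j ∈ ys) × (∀ j → j ∈ ys → j ≢ u → Differ j))
  paddedDifferences k short = differences ++ pad , length-padded , complete , sound
    where
    pad = replicate (k ∸ length differences) u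
    length-padded : length (differences ++ pad) ≡ k
    length-padded = trans (length-++ differences)
      (trans (cong (length differences +_) (length-replicate (k ∸ length differences))) (m+[n∸m]≡n short))
    complete : ∀ j → Differ j → j ∈ differences ++ pad
    complete j differ = ∈-++⁺ˡ (∈-filter⁺ differ? (∈-allFin j) differ)
    sound : ∀ j → j ∈ differences ++ pad → j ≢ u → Differ j
    sound j j∈ j≢u with ∈-++⁻ differences j∈
    ... | inj₁ j∈d = proj₂ (∈-filter⁻ differ? {xs = allFin (suc n)} j∈d)
    ... | inj₂ j∈p = contradiction (All.lookup (All.replicate⁺ {P = _≡ u} _ refl) j∈p) j≢u

-- The list of codes and its length

module _ (K : ℕ) where

  steps : ∀ n → List (Fin (suc n) × Fin n × List (Fin (suc n)))
  steps n = cartesianProduct (allFin (suc n)) (cartesianProduct (allFin n) (words (suc K) (allFin (suc n))))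

  applyStep : ∀ {n} → Matrix n → Fin (suc n) × Fin n × List (Fin (suc n)) → Matrix (suc n)
  applyStep g (u , v , ys) = extend g u v ys

  -- Repetitions and matrices of graphs that are not U-free are harmless, as only an upper bound on
  -- the length is wanted. One vertex is a base case because a step needs a twin.
  codes : ∀ n → List (Matrix n)
  codes zero          = (λ ()) ∷ []
  codes (suc zero)    = (λ _ _ → false) ∷ []
  codes (suc (suc n)) = cartesianProductWith applyStep (codes (suc n)) (steps (suc n))

  length-steps : ∀ n → length (steps n) ≡ suc n * (n * suc n ^ suc K)
  length-steps n = begin
    length (steps n)
      ≡⟨ length-cartesianProductWith _,_ (allFin (suc n)) (cartesianProduct (allFin n) strings) ⟩
    length (allFin (suc n)) * length (cartesianProduct (allFin n) strings)
      ≡⟨ cong₂ _*_ (length-allFin (suc n)) (length-cartesianProductWith _,_ (allFin n) strings) ⟩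
    suc n * (length (allFin n) * length strings)
      ≡⟨ cong (suc n *_) (cong₂ _*_ (length-allFin n) (length-words (suc K) (allFin (suc n)))) ⟩
    suc n * (n * length (allFin (suc n)) ^ suc K)
      ≡⟨ cong (λ m → suc n * (n * m ^ suc K)) (length-allFin (suc n)) ⟩
    suc n * (n * suc n ^ suc K) ∎
    where
    open ≡-Reasoning
    strings = words (suc K) (allFin (suc n))

  -- A step names `u`, `v` and `suc K` differences, hence `3 + K` vertices with at most `N` choices
  -- each.
  length-codes : ∀ N n → n ≤ N → length (codes n) ≤ (N ^ (3 + K)) ^ n
  length-codes N zero          n≤N = ≤-refl
  length-codes N (suc zero)    1≤N = m^n>0 (N ^ (3 + K)) {{m^n≢0 N (3 + K) {{>-nonZero 1≤N}}}} 1
  length-codes N (suc (suc n)) n≤N = begin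
    length (codes (suc (suc n)))
      ≡⟨ length-cartesianProductWith applyStep (codes (suc n)) (steps (suc n)) ⟩
    length (codes (suc n)) * length (steps (suc n))
      ≡⟨ cong (length (codes (suc n)) *_) (length-steps (suc n)) ⟩
    length (codes (suc n)) * (suc (suc n) * (suc n * suc (suc n) ^ suc K))
      ≤⟨ *-mono-≤ (length-codes N (suc n) n+1≤N)
           (*-mono-≤ n≤N (*-mono-≤ n+1≤N (^-monoˡ-≤ (suc K) n≤N))) ⟩
    (N ^ (3 + K)) ^ suc n * N ^ (3 + K)
      ≡⟨ *-comm ((N ^ (3 + K)) ^ suc n) _ ⟩
    (N ^ (3 + K)) ^ suc (suc n) ∎
    where
    open ≤-Reasoning
    n+1≤N : suc n ≤ N
    n+1≤N = ≤-trans (n≤1+n (suc n)) n≤N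

  Coded : ∀ {n} → Graph n → Set
  Coded {n} G = ∃[ g ] (g ∈ codes n × ∀ i j → g i j ≡ adj G i j)

  -- Being distinct from `u`, the twin `w` survives the deletion and can serve as the reference row.
  -- Padding gives the list of differences the fixed length expected by `steps`.
  Coded-deleteVertex : ∀ {n} (G : Graph (suc (suc n))) u w → u ≢ w → distance G u w ≤ K →
    Coded (deleteVertex G u) → Coded G
  Coded-deleteVertex {n} G u w u≢w near (g , g∈codes , g≡G) with punchView u w
  ... | hole    = contradiction refl u≢w
  ... | other v with ys , len , complete , sound ←
    paddedDifferences G u v (suc K) (≤-trans (length-differences G u v) (s≤s near))
    = extend g u v ys
    , ∈-cartesianProductWith⁺ applyStep g∈codes
        (∈-cartesianProduct⁺ (∈-allFin u) (∈-cartesianProduct⁺ (∈-allFin v)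
          (subst (λ m → ys ∈ words m vertices) len (∈-words vertices ∈-allFin ys))))
    , extend-correct G u v g g≡G ys complete sound
    where vertices = allFin (suc (suc n))

  -- Vertex deletion keeps the graph U-free, so twins exist at every stage; the same `K` has to
  -- serve for all sizes up to `N`.
  codes-complete : ∀ {k} N →
    (∀ n → 2 ≤ n → n ≤ N → (G : Graph n) → UFree k G → ∃[ u ] ∃[ v ] (u ≢ v × distance G u v ≤ K)) →
    ∀ n → n ≤ N → (G : Graph n) → UFree k G → Coded G
  codes-complete N twins zero          n≤N G free = (λ ()) , here refl , λ ()
  codes-complete N twins (suc zero)    n≤N G free =
    (λ _ _ → false) , here refl , λ { zero zero → sym (irrefl G zero) }
  codes-complete N twins (suc (suc n)) n≤N G free =
    let u , w , u≢w , near = twins (suc (suc n)) (s≤s (s≤s z≤n)) n≤N G free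
    in Coded-deleteVertex G u w u≢w near
         (codes-complete N twins (suc n) (≤-trans (n≤1+n (suc n)) n≤N)
           (deleteVertex G u) (deleteVertex-UFree G u free))

-- Choice of the parameters

^-distribʳ-* : ∀ k m n → (m * n) ^ k ≡ m ^ k * n ^ k
^-distribʳ-* zero    m n = refl
^-distribʳ-* (suc k) m n = trans (cong (m * n *_) (^-distribʳ-* k m n)) (interchange m n (m ^ k) (n ^ k))
  where
  interchange : ∀ a b c d → a * b * (c * d) ≡ a * c * (b * d)
  interchange = solve-∀

^-cancelˡ-< : ∀ k {m n} → m ^ k < n ^ k → m < n
^-cancelˡ-< k m^k<n^k = ≰⇒> (λ n≤m → <⇒≱ m^k<n^k (^-monoˡ-≤ k n≤m))

locate : (f : ℕ → ℕ) → f 0 ≡ 0 → (∀ t → f t < f (suc t)) → ∀ M → ∃[ t ] (f t ≤ M × M < f (suc t))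
locate f f0≡0 increasing zero = 0 , ≤-reflexive f0≡0 , ≤-trans (s≤s z≤n) (increasing 0)
locate f f0≡0 increasing (suc M) with t , lo , hi ← locate f f0≡0 increasing M with f (suc t) ≤? suc M
... | yes le = suc t , le , ≤-<-trans hi (increasing (suc t))
... | no ¬le = t , m≤n⇒m≤1+n lo , ≰⇒> ¬le

integer-root : ∀ a .{{_ : NonZero a}} e M → ∃[ t ] (a * t ^ suc e ≤ M × M < a * suc t ^ suc e)
integer-root a e = locate (λ t → a * t ^ suc e) (*-zeroʳ a) (λ t → *-monoʳ-< a (^-monoˡ-< (suc e) (n<1+n t)))

n≤2^⌈log₂n⌉ : ∀ n → n ≤ 2 ^ ⌈log₂ n ⌉
n≤2^⌈log₂n⌉ = <-rec _ bound
  where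
  open ≤-Reasoning
  bound : ∀ n → (∀ {m} → m < n → m ≤ 2 ^ ⌈log₂ m ⌉) → n ≤ 2 ^ ⌈log₂ n ⌉
  bound zero          rec = z≤n
  bound (suc zero)    rec = ≤-refl
  bound (suc (suc n)) rec = begin
    2+n                              ≡⟨ ⌊n/2⌋+⌈n/2⌉≡n 2+n ⟨
    ⌊ 2+n /2⌋ + ⌈ 2+n /2⌉            ≤⟨ +-mono-≤ (≤-trans (⌊n/2⌋≤⌈n/2⌉ 2+n) ih) ih ⟩
    2 ^ L + 2 ^ L                    ≡⟨ cong (2 ^ L +_) (+-identityʳ (2 ^ L)) ⟨
    2 ^ suc L                        ≡⟨ cong (λ l → 2 ^ suc l) (⌈log₂⌈n/2⌉⌉≡⌈log₂n⌉∸1 2+n) ⟩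
    2 ^ suc (⌈log₂ 2+n ⌉ ∸ 1)        ≡⟨ cong (2 ^_) (m+[n∸m]≡n (⌈log₂⌉-mono-≤ {2} {2+n} (s≤s (s≤s z≤n)))) ⟩
    2 ^ ⌈log₂ 2+n ⌉                  ∎
    where
    2+n = suc (suc n)
    L = ⌈log₂ ⌈ 2+n /2⌉ ⌉
    ih : ⌈ 2+n /2⌉ ≤ 2 ^ L
    ih = rec (⌈n/2⌉<n n)

module _ (e : ℕ) where

  private
    d : ℕ
    d = suc e

  -- The factor of n^d in 4 (8 d n)^d, as it comes out of `radius-large`.
  packingConstant : ℕ
  packingConstant = 4 * 2 ^ d * (4 * d) ^ d

  4^d≤packingConstant : 4 ^ d ≤ packingConstant
  4^d≤packingConstant = ≤-trans (^-monoˡ-≤ d (m≤m*n 4 d))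
    (m≤n*m _ (4 * 2 ^ d) {{m*n≢0 4 (2 ^ d) {{_}} {{m^n≢0 2 d}}}})

  module _ (N K : ℕ) (K-large : packingConstant * N ^ e < suc K ^ d) where

    -- With t maximal subject to 4 t^d ≤ n, a violation of 4 d n < t (K + 1)
    -- would give n (K + 1)^d ≤ 4 (2 t)^d (K + 1)^d ≤ 4 (8 d n)^d.
    radius-large : ∀ n → 1 ≤ n → n ≤ N → ∀ s → n < 4 * suc (suc s) ^ d → 4 * (d * n) < suc s * suc K
    radius-large n 1≤n n≤N s n<4[t+1]^d = ≰⇒> λ le → <⇒≱ K-large (*-cancelˡ-≤ n {{>-nonZero 1≤n}} (begin
      n * suc K ^ d                                  ≤⟨ *-monoˡ-≤ (suc K ^ d) (<⇒≤ n<4[t+1]^d) ⟩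
      4 * suc t ^ d * suc K ^ d                      ≤⟨ *-monoˡ-≤ (suc K ^ d) (*-monoʳ-≤ 4 (^-monoˡ-≤ d t+1≤2t)) ⟩
      4 * (2 * t) ^ d * suc K ^ d                    ≡⟨ cong (λ x → 4 * x * suc K ^ d) (^-distribʳ-* d 2 t) ⟩
      4 * (2 ^ d * t ^ d) * suc K ^ d                ≡⟨ regroup (2 ^ d) (t ^ d) (suc K ^ d) ⟩
      4 * 2 ^ d * (t ^ d * suc K ^ d)                ≡⟨ cong (4 * 2 ^ d *_) (^-distribʳ-* d t (suc K)) ⟨
      4 * 2 ^ d * (t * suc K) ^ d                    ≤⟨ *-monoʳ-≤ (4 * 2 ^ d) (^-monoˡ-≤ d le) ⟩
      4 * 2 ^ d * (4 * (d * n)) ^ d                  ≡⟨ cong (λ x → 4 * 2 ^ d * x ^ d) (*-assoc 4 d n) ⟨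
      4 * 2 ^ d * (4 * d * n) ^ d                    ≡⟨ cong (4 * 2 ^ d *_) (^-distribʳ-* d (4 * d) n) ⟩
      4 * 2 ^ d * ((4 * d) ^ d * n ^ d)              ≡⟨ extract (4 * 2 ^ d) ((4 * d) ^ d) n (n ^ e) ⟩
      n * (packingConstant * n ^ e)                  ≤⟨ *-monoʳ-≤ n (*-monoʳ-≤ packingConstant (^-monoˡ-≤ e n≤N)) ⟩
      n * (packingConstant * N ^ e)                  ∎))
      where
      open ≤-Reasoning
      t = suc s
      t+1≤2t : suc t ≤ 2 * t
      t+1≤2t = s≤s (≤-trans (≤-reflexive (+-comm 1 s)) (+-monoʳ-≤ s (s≤s z≤n)))
      regroup : ∀ a b c → 4 * (a * b) * c ≡ 4 * a * (b * c)
      regroup = solve-∀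
      extract : ∀ a b c f → a * (b * (c * f)) ≡ c * (a * b * f)
      extract = solve-∀

    module _ (1≤N : 1 ≤ N) where

      -- Takes care of graphs with fewer than 4 vertices, and lets `3 + K` be absorbed into a
      -- multiple of `K`.
      4≤K : 4 ≤ K
      4≤K = ≤-pred (^-cancelˡ-< d (≤-<-trans
        (≤-trans 4^d≤packingConstant (m≤m*n packingConstant (N ^ e) {{m^n≢0 N e {{>-nonZero 1≤N}}}})) K-large))

      near-twins : ∀ n → 2 ≤ n → n ≤ N → (G : Graph n) → UFree (suc d) G →
        ∃[ u ] ∃[ v ] (u ≢ v × distance G u v ≤ K)
      near-twins n@(suc (suc _)) 2≤n@(s≤s (s≤s _)) n≤N G free with integer-root 4 e n
      -- Here n is below 4, so any two vertices are within distance `K`.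
      ... | zero , _ , n<4 = zero , suc zero , (λ ()) ,
        ≤-trans (distance≤n G zero (suc zero)) (≤-trans (<⇒≤ (<-≤-trans n<4 (≤-reflexive (cong (4 *_) (^-zeroˡ d))))) 4≤K)
      ... | suc s , 4t^d≤n , n<4[t+1]^d =
        close-pair G free s K large (radius-large n (≤-trans (n≤1+n 1) 2≤n) n≤N s n<4[t+1]^d)
        where
        open ≤-Reasoning
        -- With t = `suc s`, the tuple length `s` is at most t^d, so 4 t^d bounds the left side;
        -- hence the factor 4 in the choice of t.
        large : 2 * (suc s ^ d + s) ≤ n
        large = begin
          2 * (suc s ^ d + s)          ≤⟨ *-monoʳ-≤ 2 (+-monoʳ-≤ (suc s ^ d)
                                            (≤-trans (n≤1+n s) (m≤m*n (suc s) (suc s ^ e) {{m^n≢0 (suc s) e}}))) ⟩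
          2 * (suc s ^ d + suc s ^ d)  ≡⟨ double (suc s ^ d) ⟩
          4 * suc s ^ d                ≤⟨ 4t^d≤n ⟩
          n                            ∎
          where
          double : ∀ a → 2 * (a + a) ≡ 4 * a
          double = solve-∀

-- Bounding `X ^ d` expresses the exponent N^(2-1/d) log N without roots: its d-th power is N^(2d-1)
-- times the d-th power of the logarithm.
theorem15 : ∀ (d : ℕ) → 1 ≤ d →
    ∃[ C ] ∀ (N : ℕ) → 2 ≤ N →
    ∃[ X ] ((X ^ d ≤ C * N ^ (2 * d ∸ 1) * ⌈log₂ N ⌉ ^ d) ×
    (∀ (gs : List (Graph N)) → AllPairs Distinct gs →
    All (UFree (suc d)) gs → length gs ≤ 2 ^ X))
theorem15 d@(suc e) _ = 4 ^ d * packingConstant e , bound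
  where
  bound : ∀ N → 2 ≤ N →
    ∃[ X ] ((X ^ d ≤ 4 ^ d * packingConstant e * N ^ (2 * d ∸ 1) * ⌈log₂ N ⌉ ^ d) ×
            (∀ (gs : List (Graph N)) → AllPairs Distinct gs → All (UFree (suc d)) gs → length gs ≤ 2 ^ X))
  -- `K` has order N^(1-1/d). The upper estimate of the root provides near-twins within `K`, the
  -- lower one bounds `X`.
  bound N 2≤N with integer-root 1 e (packingConstant e * N ^ e)
  ... | K , K^d≤ , <[K+1]^d = X , X-small , count
    where
    open ≤-Reasoning
    L X : ℕ
    L = ⌈log₂ N ⌉
    -- At most `N` steps, each naming `3 + K` vertices of `L` bits.
    X = L * (3 + K) * N
    K-large : packingConstant e * N ^ e < suc K ^ d
    K-large = <-≤-trans <[K+1]^d (≤-reflexive (*-identityˡ (suc K ^ d)))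
    1≤N : 1 ≤ N
    1≤N = ≤-trans (n≤1+n 1) 2≤N
    3+K≤4*K : 3 + K ≤ 4 * K
    3+K≤4*K = ≤-trans (≤-reflexive (+-comm 3 K))
      (+-monoʳ-≤ K (*-monoʳ-≤ 3 (≤-trans (s≤s z≤n) (4≤K e N K K-large 1≤N))))
    X-small : X ^ d ≤ 4 ^ d * packingConstant e * N ^ (2 * d ∸ 1) * L ^ d
    X-small = begin
      (L * (3 + K) * N) ^ d                ≤⟨ ^-monoˡ-≤ d (*-monoˡ-≤ N (*-monoʳ-≤ L 3+K≤4*K)) ⟩
      (L * (4 * K) * N) ^ d                ≡⟨ ^-distribʳ-* d (L * (4 * K)) N ⟩
      (L * (4 * K)) ^ d * N ^ d            ≡⟨ cong (_* N ^ d) (^-distribʳ-* d L (4 * K)) ⟩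
      L ^ d * (4 * K) ^ d * N ^ d          ≡⟨ cong (λ x → L ^ d * x * N ^ d) (^-distribʳ-* d 4 K) ⟩
      L ^ d * (4 ^ d * K ^ d) * N ^ d
        ≤⟨ *-monoˡ-≤ (N ^ d) (*-monoʳ-≤ (L ^ d) (*-monoʳ-≤ (4 ^ d)
             (≤-trans (≤-reflexive (sym (*-identityˡ (K ^ d)))) K^d≤))) ⟩
      L ^ d * (4 ^ d * (packingConstant e * N ^ e)) * N ^ d
        ≡⟨ regroup (L ^ d) (4 ^ d) (packingConstant e) (N ^ e) (N ^ d) ⟩
      4 ^ d * packingConstant e * (N ^ e * N ^ d) * L ^ d
        ≡⟨ cong (λ x → 4 ^ d * packingConstant e * x * L ^ d) (^-distribˡ-+-* N e d) ⟨
      4 ^ d * packingConstant e * N ^ (e + d) * L ^ d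
        -- With `d` equal to `suc e`, `2 * d ∸ 1` computes to `e + (d + 0)`.
        ≡⟨ cong (λ x → 4 ^ d * packingConstant e * N ^ (e + x) * L ^ d) (+-identityʳ d) ⟨
      4 ^ d * packingConstant e * N ^ (2 * d ∸ 1) * L ^ d ∎
      where
      regroup : ∀ a b c f g → a * (b * (c * f)) * g ≡ b * c * (f * g) * a
      regroup = solve-∀
    count : ∀ (gs : List (Graph N)) → AllPairs Distinct gs → All (UFree (suc d)) gs → length gs ≤ 2 ^ X
    count gs distinct free = begin
      length gs
        ≤⟨ length≤length-of-cover (λ g G → ∀ i j → g i j ≡ adj G i j)
             (λ g≡G g≡H differ → differ (λ i j → trans (sym (g≡G i j)) (g≡H i j)))
             (codes K N) distinct
             (All.map (λ {G} → codes-complete K N (near-twins e N K K-large 1≤N) N ≤-refl G) free) ⟩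
      length (codes K N)       ≤⟨ length-codes K N N ≤-refl ⟩
      (N ^ (3 + K)) ^ N        ≤⟨ ^-monoˡ-≤ N (^-monoˡ-≤ (3 + K) (n≤2^⌈log₂n⌉ N)) ⟩
      ((2 ^ L) ^ (3 + K)) ^ N  ≡⟨ cong (_^ N) (^-*-assoc 2 L (3 + K)) ⟩
      (2 ^ (L * (3 + K))) ^ N  ≡⟨ ^-*-assoc 2 (L * (3 + K)) N ⟩
      2 ^ X                    ∎
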